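{- Let $m,n,k \geq 2$. The poset $m\oplus n \oplus k$ is 2-S\l upecki if and only if $n>B(m,k)+1$.
   Context: Posets are viewed as reflexive digraphs with arc relation $\leq$. For $n\geq1$, $n$ also denotes the $n$-element antichain; the ordinal sum $\mathbb{P}\oplus\mathbb{Q}$ is the disjoint union with additionally $p\leq q$ for all $p\in P$, $q\in Q$. A binary polymorphism is a monotone map $\mathbb{P}^2\to\mathbb{P}$; it is essentially unary if it equals $(x_1,x_2)\mapsto g(x_i)$ for some $i$ and monotone $g:\mathbb{P}\to\mathbb{P}$. $\mathbb{P}$ is 2-S\l upecki if all its surjective binary polymorphisms are essentially unary. For integers $m,k\geq2$, $\mu(m,k)$ is the maximum of $\alpha\gamma+\beta\delta$ over integers $\alpha,\beta,\gamma,\delta$ with $0<\alpha,\beta<m$, $0<\gamma,\delta<k$, $(m-\alpha)(m-\beta)\geq m-1$ and $(k-\gamma)(k-\delta)\geq k-1$, and $B(m,k)=\max(\mu(m,k),mk)$ (with the convention that the maximum is $mk$ if no such integers exist). -}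

module Defs where

open import Data.Nat using (ℕ; zero; suc; _+_; _*_; _∸_; _≤_; _<_; _⊔_; _≤?_; _<?_)
open import Data.Fin using (Fin)
open import Data.Sum using (_⊎_; inj₁; inj₂)
open import Data.Product using (Σ; ∃; _×_; _,_)
open import Data.List using (List; upTo; concatMap; foldr; map)
open import Data.Bool using (Bool; true; false; if_then_else_; _∧_)
open import Relation.Nullary.Decidable using (⌊_⌋)
open import Relation.Binary.PropositionalEquality using (_≡_)

-- The poset  m ⊕ n ⊕ k  (ordinal sum of three antichains)

Elt : ℕ → ℕ → ℕ → Set
Elt m n k = Fin m ⊎ (Fin n ⊎ Fin k)

lvl : ∀ {m n k} → Elt m n k → ℕ
lvl (inj₁ _)        = 0
lvl (inj₂ (inj₁ _)) = 1
lvl (inj₂ (inj₂ _)) = 2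

_≼_ : ∀ {m n k} → Elt m n k → Elt m n k → Set
x ≼ y = x ≡ y ⊎ lvl x < lvl y

Monotone₁ : {A : Set} → (A → A → Set) → (A → A) → Set
Monotone₁ {A} _≤ₚ_ g = ∀ (x y : A) → x ≤ₚ y → g x ≤ₚ g y

Monotone₂ : {A : Set} → (A → A → Set) → (A → A → A) → Set
Monotone₂ {A} _≤ₚ_ f =
  ∀ (x₁ x₂ y₁ y₂ : A) → x₁ ≤ₚ y₁ → x₂ ≤ₚ y₂ → f x₁ x₂ ≤ₚ f y₁ y₂

Surjective₂ : {A : Set} → (A → A → A) → Set
Surjective₂ {A} f = ∀ (z : A) → Σ A λ x → Σ A λ y → f x y ≡ z

EssentiallyUnary : {A : Set} → (A → A → Set) → (A → A → A) → Set
EssentiallyUnary {A} _≤ₚ_ f =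
  Σ (A → A) λ g → Monotone₁ _≤ₚ_ g ×
    ((∀ (x y : A) → f x y ≡ g x) ⊎ (∀ (x y : A) → f x y ≡ g y))

TwoSlupecki : (A : Set) → (A → A → Set) → Set
TwoSlupecki A _≤ₚ_ =
  ∀ (f : A → A → A) → Monotone₂ _≤ₚ_ f → Surjective₂ f → EssentiallyUnary _≤ₚ_ f

admissible : ℕ → ℕ → ℕ → Bool
admissible m α β =
  ⌊ 0 <? α ⌋ ∧ ⌊ α <? m ⌋ ∧ ⌊ 0 <? β ⌋ ∧ ⌊ β <? m ⌋ ∧
  ⌊ m ∸ 1 ≤? (m ∸ α) * (m ∸ β) ⌋

maxList : List ℕ → ℕ
maxList = foldr _⊔_ 0

muCandidates : ℕ → ℕ → List ℕ
muCandidates m k =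
  concatMap (λ α → concatMap (λ β → concatMap (λ γ → map (λ δ →
      if admissible m α β ∧ admissible k γ δ
        then α * γ + β * δ else 0)
    (upTo k)) (upTo k)) (upTo m)) (upTo m)

-- B(m,k) = max(μ(m,k), mk); equals mk when no admissible tuple exists.
-- (Since every admissible value is > 0 ≤ mk, padding with 0 is harmless.)
B : ℕ → ℕ → ℕ
B m k = (m * k) ⊔ maxList (muCandidates m k)

{-# OPTIONS --safe #-}
-- Write M, N, K for the three antichains and let f be monotone and surjective.
-- Then f maps N × N into N.  If f is not constant there, say it varies with its
-- first argument, then monotonicity forces f to ignore its second argument
-- everywhere.  If f is constant on N × N with value v₀, a value in N other than
-- v₀ can only be taken at a pair in M × K or K × M.  At (x , z) ∈ M × K this
-- needs the row of x to be constant on M ∪ N and the column of z to be constant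
-- on N ∪ K.  With α constant rows and β constant columns in M × M, and γ constant
-- columns and δ constant rows in K × K, this gives n ≤ αγ + βδ + 1.  If α, β > 0,
-- all constant rows and columns of M × M share one value, so the other
-- (m − α)(m − β) entries take the remaining m − 1 values.  Conversely, filling
-- the αγ + βδ free entries with arbitrary elements of N gives a polymorphism that
-- depends on both arguments; α = m, γ = k, β = δ = 0 yields the bound mk.
module Submission where

open import Defs
open import Data.Bool using (Bool; true; false; T; if_then_else_; _∧_)
open import Data.Bool.Properties using (T-∧; T-≡)
open import Data.Fin using (Fin; zero; suc; toℕ; fromℕ<; inject≤; cast; splitAt; join; combine; remQuot; _↑ˡ_; _↑ʳ_)
open import Data.Fin.Properties using (_≟_; any?; injective⇒≤; remQuot-combine; combine-remQuot; splitAt⁻¹-↑ˡ; splitAt⁻¹-↑ʳ; splitAt-↑ˡ; splitAt-↑ʳ; splitAt-join; cast-involutive; toℕ-inject≤; toℕ<n; toℕ-fromℕ<; toℕ-injective)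
open import Data.List using (upTo)
open import Data.List.Membership.Propositional using (_∈_; lose; find)
open import Data.List.Membership.Propositional.Properties using (∈-concatMap⁺; ∈-concatMap⁻; ∈-map⁺; ∈-map⁻; ∈-upTo⁺; foldr-selective)
open import Data.List.Properties using (foldr-preservesᵒ)
import Data.List.Relation.Unary.Any as Any
open import Data.Maybe using (Maybe; just; nothing)
open import Data.Nat using (ℕ; zero; suc; _+_; _*_; _∸_; _⊔_; _≤_; _<_; z≤n; s≤s; _<?_; _≤?_)
open import Data.Nat.Properties using (≤-refl; ≤-trans; ≤-reflexive; m≤n⇒m≤n⊔o; m≤n⇒m≤o⊔n; m≤m⊔n; m≤n⊔m; ⊔-sel; m+[n∸m]≡n; m+n∸m≡n; <⇒≤; m≤m+n; m<m+n; *-mono-≤; *-comm; *-zeroʳ; +-identityʳ; +-comm; +-suc; ∸-monoˡ-≤; ≮⇒≥; <⇒≱; <-trans; ≤-pred)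
open import Data.Product using (∃; _×_; _,_; proj₁; proj₂; uncurry)
open import Data.Sum using (_⊎_; inj₁; inj₂)
open import Function using (_∘_; flip; id; case_of_)
open import Function.Bundles using (_⇔_; mk⇔; Equivalence)
open import Relation.Binary.PropositionalEquality using (_≡_; _≢_; refl; sym; trans; cong; cong₂; subst)
open import Relation.Nullary using (¬_; Dec; yes; no; contradiction)
open import Relation.Nullary.Decidable using (⌊_⌋; ¬?; decidable-stable; toWitness; fromWitness)

-- The bound B

-- The complements `α′` and `β′` are data, so truncated subtraction disappears. For `2 ≤ m`,
-- `enough` implies `α < m`, since `α′ = 0` would give `m ≤ 1`; likewise for `β`.
record Admissible (m α β : ℕ) : Set where
  field
    0<α : 0 < α
    0<β : 0 < β
    α′ β′ : ℕ
    α+α′≡m : α + α′ ≡ m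
    β+β′≡m : β + β′ ≡ m
    enough : m ≤ suc (α′ * β′)

open Admissible

⌊⌋∧⁻ : ∀ {P : Set} {b} (P? : Dec P) → T (⌊ P? ⌋ ∧ b) → P × T b
⌊⌋∧⁻ (yes p) t = p , t

⌊⌋∧⁺ : ∀ {P : Set} {b} (P? : Dec P) → P → T b → T (⌊ P? ⌋ ∧ b)
⌊⌋∧⁺ (yes _) _ t = t
⌊⌋∧⁺ (no ¬p) p _ = contradiction p ¬p

admissible⇒Admissible : ∀ {m α β} → T (admissible m α β) → Admissible m α β
admissible⇒Admissible {m} {α} {β} t
  with 0<α , t ← ⌊⌋∧⁻ (0 <? α) t
  with α<m , t ← ⌊⌋∧⁻ (α <? m) t
  with 0<β , t ← ⌊⌋∧⁻ (0 <? β) t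
  with β<m , t ← ⌊⌋∧⁻ (β <? m) t
  = record
  { 0<α = 0<α ; 0<β = 0<β
  ; α′ = m ∸ α ; β′ = m ∸ β
  ; α+α′≡m = m+[n∸m]≡n (<⇒≤ α<m)
  ; β+β′≡m = m+[n∸m]≡n (<⇒≤ β<m)
  ; enough = pred≤⇒≤suc m (toWitness {a? = m ∸ 1 ≤? (m ∸ α) * (m ∸ β)} t)
  }
  where
  pred≤⇒≤suc : ∀ m {i} → m ∸ 1 ≤ i → m ≤ suc i
  pred≤⇒≤suc zero    _ = z≤n
  pred≤⇒≤suc (suc _) p = s≤s p

Admissible-swap : ∀ {m α β} → Admissible m α β → Admissible m β α
Admissible-swap {m} a = record
  { 0<α = 0<β a ; 0<β = 0<α a ; α′ = β′ a ; β′ = α′ a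
  ; α+α′≡m = β+β′≡m a ; β+β′≡m = α+α′≡m a
  ; enough = subst (λ i → m ≤ suc i) (*-comm (α′ a) (β′ a)) (enough a) }

Admissible⇒< : ∀ {m α β} → 2 ≤ m → Admissible m α β → α < m
Admissible⇒< 2≤m record { α′ = zero ; enough = m≤1 } = contradiction m≤1 (<⇒≱ 2≤m)
Admissible⇒< {α = α} _ record { α′ = suc _ ; α+α′≡m = refl } = m<m+n α (s≤s z≤n)

Admissible⇒admissible : ∀ {m α β} → 2 ≤ m → Admissible m α β → T (admissible m α β)
Admissible⇒admissible {m} {α} {β} 2≤m a =
  ⌊⌋∧⁺ (0 <? α) (0<α a) (⌊⌋∧⁺ (α <? m) (Admissible⇒< 2≤m a)
    (⌊⌋∧⁺ (0 <? β) (0<β a) (⌊⌋∧⁺ (β <? m) (Admissible⇒< 2≤m (Admissible-swap a))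
      (fromWitness {a? = m ∸ 1 ≤? (m ∸ α) * (m ∸ β)}
        (subst (m ∸ 1 ≤_) (sym (cong₂ _*_ (compl α (α+α′≡m a)) (compl β (β+β′≡m a))))
          (∸-monoˡ-≤ 1 (enough a)))))))
  where
  compl : ∀ a {b} → a + b ≡ m → m ∸ a ≡ b
  compl a {b} refl = m+n∸m≡n a b

mk≤B : ∀ m k → m * k ≤ B m k
mk≤B m k = m≤m⊔n (m * k) _

μ≤B : ∀ {m k α β γ δ} → 2 ≤ m → 2 ≤ k → Admissible m α β → Admissible k γ δ →
      α * γ + β * δ ≤ B m k
μ≤B {m} {k} {α} {β} {γ} {δ} 2≤m 2≤k aₘ aₖ =
  ≤-trans (foldr-preservesᵒ ≤-⊔ 0 (muCandidates m k)
            (inj₂ (Any.map (λ { refl → ≤-refl }) value∈)))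
          (m≤n⊔m (m * k) _)
  where
  ≤-⊔ : ∀ x y → α * γ + β * δ ≤ x ⊎ α * γ + β * δ ≤ y → α * γ + β * δ ≤ x ⊔ y
  ≤-⊔ x y (inj₁ p) = m≤n⇒m≤n⊔o y p
  ≤-⊔ x y (inj₂ p) = m≤n⇒m≤o⊔n x p
  cand : ℕ → ℕ → ℕ → ℕ → ℕ
  cand α β γ δ = if admissible m α β ∧ admissible k γ δ then α * γ + β * δ else 0
  cand≡ : cand α β γ δ ≡ α * γ + β * δ
  cand≡ rewrite Equivalence.to T-≡ (Equivalence.from T-∧
          (Admissible⇒admissible 2≤m aₘ , Admissible⇒admissible 2≤k aₖ)) = refl
  value∈ : α * γ + β * δ ∈ muCandidates m k
  value∈ = subst (_∈ muCandidates m k) cand≡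
    (∈-concatMap⁺ _ (lose (∈-upTo⁺ (Admissible⇒< 2≤m aₘ))
    (∈-concatMap⁺ _ (lose (∈-upTo⁺ (Admissible⇒< 2≤m (Admissible-swap aₘ)))
    (∈-concatMap⁺ _ (lose (∈-upTo⁺ (Admissible⇒< 2≤k aₖ))
    (∈-map⁺ (cand α β γ) (∈-upTo⁺ (Admissible⇒< 2≤k (Admissible-swap aₖ))))))))))

-- If one of the four numbers is 0, one product vanishes and the other is at most `m * k`. If all
-- are positive, both pairs are admissible and the sum is one of the candidates.
αγ+βδ≤B : ∀ {m k} α β γ δ → 2 ≤ m → 2 ≤ k → α ≤ m → β ≤ m → γ ≤ k → δ ≤ k →
  (0 < α → 0 < β → Admissible m α β) → (0 < γ → 0 < δ → Admissible k γ δ) →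
  α * γ + β * δ ≤ B m k
αγ+βδ≤B {m} {k} zero β γ δ _ _ _ β≤ _ δ≤ _ _ = ≤-trans (*-mono-≤ β≤ δ≤) (mk≤B m k)
αγ+βδ≤B {m} {k} α@(suc _) zero γ δ _ _ α≤ _ γ≤ _ _ _ =
  ≤-trans (≤-reflexive (+-identityʳ (α * γ))) (≤-trans (*-mono-≤ α≤ γ≤) (mk≤B m k))
αγ+βδ≤B {m} {k} α@(suc _) β@(suc _) zero δ _ _ _ β≤ _ δ≤ _ _ =
  ≤-trans (≤-reflexive (cong (_+ β * δ) (*-zeroʳ α))) (≤-trans (*-mono-≤ β≤ δ≤) (mk≤B m k))
αγ+βδ≤B {m} {k} α@(suc _) β@(suc _) γ@(suc _) zero _ _ α≤ _ γ≤ _ _ _ =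
  ≤-trans (≤-reflexive (trans (cong (α * γ +_) (*-zeroʳ β)) (+-identityʳ (α * γ))))
          (≤-trans (*-mono-≤ α≤ γ≤) (mk≤B m k))
αγ+βδ≤B (suc _) (suc _) (suc _) (suc _) 2≤m 2≤k _ _ _ _ aₘ aₖ =
  μ≤B 2≤m 2≤k (aₘ (s≤s z≤n) (s≤s z≤n)) (aₖ (s≤s z≤n) (s≤s z≤n))

-- The maximum is `m * k`, an entry of the list, or the base value 0 of the fold. The base value and
-- the padding 0 both fall under `i ≤ m * k`.
≤B⇒≤mk⊎≤μ : ∀ m k {i} → i ≤ B m k → i ≤ m * k ⊎
  (∃ λ α → ∃ λ β → ∃ λ γ → ∃ λ δ →
     Admissible m α β × Admissible k γ δ × i ≤ α * γ + β * δ)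
≤B⇒≤mk⊎≤μ m k {i} i≤B with ⊔-sel (m * k) (maxList (muCandidates m k))
... | inj₁ B≡mk = inj₁ (subst (i ≤_) B≡mk i≤B)
... | inj₂ B≡μ with foldr-selective ⊔-sel 0 (muCandidates m k)
...   | inj₁ μ≡0 = inj₁ (≤-trans (subst (i ≤_) (trans B≡μ μ≡0) i≤B) z≤n)
...   | inj₂ μ∈
  with α , _ , ∈₁ ← find (∈-concatMap⁻ _ {xs = upTo m} μ∈)
  with β , _ , ∈₂ ← find (∈-concatMap⁻ _ {xs = upTo m} ∈₁)
  with γ , _ , ∈₃ ← find (∈-concatMap⁻ _ {xs = upTo k} ∈₂)
  with δ , _ , μ≡ ← ∈-map⁻ _ ∈₃
  = from-candidate _ refl (subst (i ≤_) (trans B≡μ μ≡) i≤B)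
  where
  -- The test is generalised to a Boolean `b`, so that matching reduces the `if` while the equation
  -- still yields admissibility.
  from-candidate : ∀ b → admissible m α β ∧ admissible k γ δ ≡ b →
    i ≤ (if b then α * γ + β * δ else 0) → _
  from-candidate true eq i≤ with aₘ , aₖ ← Equivalence.to T-∧ (Equivalence.from T-≡ eq) =
    inj₂ (α , β , γ , δ , admissible⇒Admissible aₘ , admissible⇒Admissible aₖ , i≤)
  from-candidate false _ i≤0 = inj₁ (≤-trans i≤0 z≤n)

-- Counting

-- Choosing preimages gives an injection from `Fin b` to `Fin a`.
onto⇒≤ : ∀ {a b} (s : Fin a → Fin b) → (∀ v → ∃ λ i → s i ≡ v) → b ≤ a
onto⇒≤ s onto = injective⇒≤ {f = proj₁ ∘ onto} λ {v} {w} eq →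
  trans (sym (proj₂ (onto v))) (trans (cong s eq) (proj₂ (onto w)))

-- This count serves twice: for `n ≤ αγ + βδ + 1`, and, with an empty second family, for the
-- condition `enough`.
covered⇒≤ : ∀ {n a b c d} (v₀ : Fin n)
  (F : Fin a → Fin b → Fin n) (G : Fin c → Fin d → Fin n) →
  (∀ v → v ≡ v₀ ⊎ (∃ λ i → ∃ λ j → F i j ≡ v) ⊎ (∃ λ i → ∃ λ j → G i j ≡ v)) →
  n ≤ suc (a * b + c * d)
covered⇒≤ {n} {a} {b} {c} {d} v₀ F G cover = onto⇒≤ s onto
  where
  s₂ : Fin (a * b) ⊎ Fin (c * d) → Fin n
  s₂ (inj₁ i) = uncurry F (remQuot b i)
  s₂ (inj₂ i) = uncurry G (remQuot d i)
  s : Fin (suc (a * b + c * d)) → Fin n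
  s zero    = v₀
  s (suc i) = s₂ (splitAt (a * b) i)
  onto : ∀ v → ∃ λ i → s i ≡ v
  onto v with cover v
  ... | inj₁ v≡v₀ = zero , sym v≡v₀
  ... | inj₂ (inj₁ (i , j , eq)) = suc (combine i j ↑ˡ (c * d)) ,
    trans (cong s₂ (splitAt-↑ˡ (a * b) (combine i j) (c * d)))
          (trans (cong (uncurry F) (remQuot-combine i j)) eq)
  ... | inj₂ (inj₂ (i , j , eq)) = suc ((a * b) ↑ʳ combine i j) ,
    trans (cong s₂ (splitAt-↑ʳ (a * b) (c * d) (combine i j)))
          (trans (cong (uncurry G) (remQuot-combine i j)) eq)

record Partition {m} (A : Fin m → Bool) : Set where
  field
    #in #out : ℕ
    total    : #in + #out ≡ m
    in-elt   : Fin #in → Fin m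
    out-elt  : Fin #out → Fin m
    in-true  : ∀ i → A (in-elt i) ≡ true
    in-onto  : ∀ x → A x ≡ true → ∃ λ i → in-elt i ≡ x
    out-onto : ∀ x → A x ≡ false → ∃ λ i → out-elt i ≡ x

open Partition

partition : ∀ {m} (A : Fin m → Bool) → Partition A
partition {zero} A = record
  { #in = 0 ; #out = 0 ; total = refl ; in-elt = λ () ; out-elt = λ ()
  ; in-true = λ () ; in-onto = λ () ; out-onto = λ () }
partition {suc m} A with partition (A ∘ suc) | A zero in eq
... | P | true = record
  { #in = suc (#in P) ; #out = #out P ; total = cong suc (total P)
  ; in-elt = λ { zero → zero ; (suc i) → suc (in-elt P i) }
  ; out-elt = suc ∘ out-elt P
  ; in-true = λ { zero → eq ; (suc i) → in-true P i }
  ; in-onto = λ { zero _ → zero , refl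
                ; (suc x) t → let i , e = in-onto P x t in suc i , cong suc e }
  ; out-onto = λ { zero t → case trans (sym eq) t of λ ()
                 ; (suc x) t → let i , e = out-onto P x t in i , cong suc e } }
... | P | false = record
  { #in = #in P ; #out = suc (#out P)
  ; total = trans (+-suc (#in P) (#out P)) (cong suc (total P))
  ; in-elt = suc ∘ in-elt P
  ; out-elt = λ { zero → zero ; (suc i) → suc (out-elt P i) }
  ; in-true = in-true P
  ; in-onto = λ { zero t → case trans (sym eq) t of λ ()
                ; (suc x) t → let i , e = in-onto P x t in i , cong suc e }
  ; out-onto = λ { zero _ → zero , refl
                 ; (suc x) t → let i , e = out-onto P x t in suc i , cong suc e } }

#in≤ : ∀ {m} {A : Fin m → Bool} (P : Partition A) → #in P ≤ m
#in≤ P = subst (#in P ≤_) (total P) (m≤m+n (#in P) (#out P))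

-- A constant row and a constant column meet, so they all share the value r.
constant-lines-Admissible : ∀ {m} (p : Fin m → Fin m → Fin m) {R C : Fin m → Bool} →
  (∀ a → ∃ λ x → ∃ λ y → p x y ≡ a) →
  (∀ x → R x ≡ true → ∀ y y′ → p x y ≡ p x y′) →
  (∀ y → C y ≡ true → ∀ x x′ → p x y ≡ p x′ y) →
  (PR : Partition R) (PC : Partition C) → 0 < #in PR → 0 < #in PC →
  Admissible m (#in PR) (#in PC)
constant-lines-Admissible {m} p {R} {C} onto rows cols PR PC 0<r 0<c = record
  { 0<α = 0<r ; 0<β = 0<c ; α+α′≡m = total PR ; β+β′≡m = total PC
  ; enough = subst (λ i → m ≤ suc i) (+-identityʳ _)
      (covered⇒≤ {c = 0} {d = 0} r (λ i j → p (out-elt PR i) (out-elt PC j)) (λ ()) cover) }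
  where
  x₀ y₀ r : Fin m
  x₀ = in-elt PR (fromℕ< 0<r)
  y₀ = in-elt PC (fromℕ< 0<c)
  r  = p x₀ y₀
  -- Follow row `x` to column `y₀`, then that constant column to `x₀`.
  row≡r : ∀ x y → R x ≡ true → p x y ≡ r
  row≡r x y t = trans (rows x t y y₀) (cols y₀ (in-true PC _) x x₀)
  col≡r : ∀ x y → C y ≡ true → p x y ≡ r
  col≡r x y t = trans (cols y t x x₀) (rows x₀ (in-true PR _) y y₀)
  cover : ∀ v → v ≡ r ⊎ (∃ λ i → ∃ λ j → p (out-elt PR i) (out-elt PC j) ≡ v) ⊎ _
  cover v with onto v
  ... | x , y , refl with R x in Rx | C y in Cy
  ...   | true  | _     = inj₁ (row≡r x y Rx)
  ...   | false | true  = inj₁ (col≡r x y Cy)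
  ...   | false | false with i , refl ← out-onto PR x Rx | j , refl ← out-onto PC y Cy =
    inj₂ (inj₁ (i , j , refl))

-- Surplus indices go to `zero`, a value that the constructions below attain elsewhere, so only the
-- values `suc v` have to be hit here.
clamp : ∀ {a b} → Fin a → Fin (suc b)
clamp {b = b} i with toℕ i <? b
... | yes i<b = suc (fromℕ< i<b)
... | no  _   = zero

clamp-onto : ∀ {a b} → b ≤ a → (v : Fin b) → ∃ λ (i : Fin a) → clamp i ≡ suc v
clamp-onto {a} {b} b≤a v = inject≤ v b≤a , eq
  where
  eq : clamp (inject≤ v b≤a) ≡ suc v
  eq with toℕ (inject≤ v b≤a) <? b
  ... | yes i<b = cong suc (toℕ-injective (trans (toℕ-fromℕ< i<b) (toℕ-inject≤ v b≤a)))
  ... | no  i≮b = contradiction (subst (_< b) (sym (toℕ-inject≤ v b≤a)) (toℕ<n v)) i≮b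

-- The order of m ⊕ n ⊕ k

pattern bot x = inj₁ x
pattern mid x = inj₂ (inj₁ x)
pattern top x = inj₂ (inj₂ x)

module _ {m n k : ℕ} where

  ≼-refl : {x : Elt m n k} → x ≼ x
  ≼-refl = inj₁ refl

  ≼-trans : {x y z : Elt m n k} → x ≼ y → y ≼ z → x ≼ z
  ≼-trans (inj₁ refl) q           = q
  ≼-trans (inj₂ p)    (inj₁ refl) = inj₂ p
  ≼-trans (inj₂ p)    (inj₂ q)    = inj₂ (<-trans p q)

  ≼-respʳ : {x y z : Elt m n k} → y ≡ z → x ≼ y → x ≼ z
  ≼-respʳ refl p = p

  ≼-respˡ : {x y z : Elt m n k} → x ≡ y → x ≼ z → y ≼ z
  ≼-respˡ refl p = p

  bot≼mid : ∀ {a v} → _≼_ {m} {n} {k} (bot a) (mid v)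
  bot≼mid = inj₂ (s≤s z≤n)

  bot≼top : ∀ {a c} → _≼_ {m} {n} {k} (bot a) (top c)
  bot≼top = inj₂ (s≤s z≤n)

  mid≼top : ∀ {v c} → _≼_ {m} {n} {k} (mid v) (top c)
  mid≼top = inj₂ (s≤s (s≤s z≤n))

  ≼bot⇒≡ : ∀ {x : Elt m n k} {a} → x ≼ bot a → x ≡ bot a
  ≼bot⇒≡ (inj₁ eq) = eq

  top≼⇒≡ : ∀ {x : Elt m n k} {c} → top c ≼ x → x ≡ top c
  top≼⇒≡ (inj₁ eq) = sym eq
  top≼⇒≡ {bot _} (inj₂ ())
  top≼⇒≡ {mid _} (inj₂ (s≤s ()))
  top≼⇒≡ {top _} (inj₂ (s≤s (s≤s ())))

  ≼mid⇒ : ∀ {x : Elt m n k} {v} → x ≼ mid v → (∃ λ a → x ≡ bot a) ⊎ x ≡ mid v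
  ≼mid⇒ (inj₁ eq) = inj₂ eq
  ≼mid⇒ {bot a} (inj₂ _) = inj₁ (a , refl)
  ≼mid⇒ {mid _} (inj₂ (s≤s ()))
  ≼mid⇒ {top _} (inj₂ (s≤s ()))

  mid≼⇒ : ∀ {x : Elt m n k} {v} → mid v ≼ x → (∃ λ c → x ≡ top c) ⊎ x ≡ mid v
  mid≼⇒ (inj₁ eq) = inj₂ (sym eq)
  mid≼⇒ {bot _} (inj₂ ())
  mid≼⇒ {mid _} (inj₂ (s≤s ()))
  mid≼⇒ {top c} (inj₂ _) = inj₁ (c , refl)

  mid≼mid⇒≡ : ∀ {v w} → _≼_ {m} {n} {k} (mid v) (mid w) → v ≡ w
  mid≼mid⇒≡ (inj₁ refl) = refl
  mid≼mid⇒≡ (inj₂ (s≤s ()))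

  ≼mid-≢⇒bot : ∀ {x : Elt m n k} {v w} → v ≢ w → x ≼ mid v → x ≼ mid w → ∃ λ a → x ≡ bot a
  ≼mid-≢⇒bot v≢w p q with ≼mid⇒ p | ≼mid⇒ q
  ... | inj₁ r    | _         = r
  ... | inj₂ _    | inj₁ r    = r
  ... | inj₂ refl | inj₂ refl = contradiction refl v≢w

  mid-≢≼⇒top : ∀ {x : Elt m n k} {v w} → v ≢ w → mid v ≼ x → mid w ≼ x → ∃ λ c → x ≡ top c
  mid-≢≼⇒top v≢w p q with mid≼⇒ p | mid≼⇒ q
  ... | inj₁ r    | _         = r
  ... | inj₂ _    | inj₁ r    = r
  ... | inj₂ refl | inj₂ refl = contradiction refl v≢w

  bot-below : Fin m → (p : Elt m n k) → ∃ λ x → bot x ≼ p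
  bot-below a (bot x) = x , ≼-refl
  bot-below a (mid _) = a , bot≼mid
  bot-below a (top _) = a , bot≼top

  top-above : Fin k → (p : Elt m n k) → ∃ λ x → p ≼ top x
  top-above c (bot _) = c , bot≼top
  top-above c (mid _) = c , mid≼top
  top-above c (top x) = x , ≼-refl

  isBot isTop : Elt m n k → Bool
  isBot (bot _)  = true
  isBot (inj₂ _) = false
  isTop (top _)  = true
  isTop (mid _)  = false
  isTop (bot _)  = false

  isBot⇒ : ∀ x → isBot x ≡ true → ∃ λ a → x ≡ bot a
  isBot⇒ (bot a) _ = a , refl

  isTop⇒ : ∀ x → isTop x ≡ true → ∃ λ c → x ≡ top c
  isTop⇒ (top c) _ = c , refl

  fromBot : Fin m → Elt m n k → Fin m
  fromBot _ (bot a)  = a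
  fromBot d (inj₂ _) = d

  fromMid : Fin n → Elt m n k → Fin n
  fromMid d (bot _) = d
  fromMid _ (mid v) = v
  fromMid d (top _) = d

  fromTop : Fin k → Elt m n k → Fin k
  fromTop d (bot _) = d
  fromTop d (mid _) = d
  fromTop _ (top c) = c

-- Only `bot a` itself lies below `bot a`, whereas there are at least two bottoms.
≽bots⇒≢bot : ∀ {m n k} → 2 ≤ m → {x : Elt m n k} → (∀ a → bot a ≼ x) → ∀ a → x ≢ bot a
≽bots⇒≢bot (s≤s (s≤s _)) ≽bots a refl
  with () ← trans (≼bot⇒≡ (≽bots zero)) (sym (≼bot⇒≡ (≽bots (suc zero))))

≼tops⇒≢top : ∀ {m n k} → 2 ≤ k → {x : Elt m n k} → (∀ c → x ≼ top c) → ∀ c → x ≢ top c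
≼tops⇒≢top (s≤s (s≤s _)) ≼tops c refl
  with () ← trans (top≼⇒≡ (≼tops zero)) (sym (top≼⇒≡ (≼tops (suc zero))))

between⇒mid : ∀ {m n k} → 2 ≤ m → 2 ≤ k → {x : Elt m n k} →
  (∀ a → bot a ≼ x) → (∀ c → x ≼ top c) → ∃ λ v → x ≡ mid v
between⇒mid 2≤m _ {bot a} p _ = contradiction refl (≽bots⇒≢bot 2≤m p a)
between⇒mid _ _   {mid v} _ _ = v , refl
between⇒mid _ 2≤k {top c} _ q = contradiction refl (≼tops⇒≢top 2≤k q c)

-- Surjective polymorphisms

record SurjectivePolymorphism (m n k : ℕ) : Set where
  field
    f    : Elt m n k → Elt m n k → Elt m n k
    mono : Monotone₂ _≼_ f
    onto : Surjective₂ f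

-- Transfers every result about the first argument to the second.
flipₚ : ∀ {m n k} → SurjectivePolymorphism m n k → SurjectivePolymorphism m n k
flipₚ P = record
  { f    = flip f
  ; mono = λ x₁ x₂ y₁ y₂ p q → mono x₂ x₁ y₂ y₁ q p
  ; onto = λ z → let x , y , eq = onto z in y , x , eq }
  where open SurjectivePolymorphism P

module Analysis {m n k : ℕ} (2≤m : 2 ≤ m) (2≤k : 2 ≤ k) (P : SurjectivePolymorphism m n k) where
  open SurjectivePolymorphism P

  -- `bot a` is minimal, so lowering both arguments to bottoms leaves this value unchanged.
  onto-bot : ∀ a → ∃ λ x → ∃ λ y → f (bot x) (bot y) ≡ bot a
  onto-bot a with p , q , eq ← onto (bot a)
    with x , x≼p ← bot-below a p | y , y≼q ← bot-below a q =
    x , y , ≼bot⇒≡ (≼-respʳ eq (mono _ _ _ _ x≼p y≼q))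

  onto-top : ∀ c → ∃ λ x → ∃ λ y → f (top x) (top y) ≡ top c
  onto-top c with p , q , eq ← onto (top c)
    with x , p≼x ← top-above c p | y , q≼y ← top-above c q =
    x , y , top≼⇒≡ (≼-respˡ eq (mono _ _ _ _ p≼x q≼y))

  monoˡ : ∀ {x y z} → x ≼ y → f x z ≼ f y z
  monoˡ p = mono _ _ _ _ p ≼-refl

  monoʳ : ∀ {x y z} → x ≼ y → f z x ≼ f z y
  monoʳ p = mono _ _ _ _ ≼-refl p

  -- Every `bot a` is a value on a pair of bottoms, hence lies below `f (mid w) (mid z)`; dually
  -- every `top c` lies above.
  centre-mid : ∀ w z → ∃ λ v → f (mid w) (mid z) ≡ mid v
  centre-mid w z = between⇒mid 2≤m 2≤k
    (λ a → let x , y , eq = onto-bot a in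
      ≼-respˡ eq (mono _ _ _ _ bot≼mid bot≼mid))
    (λ c → let x , y , eq = onto-top c in
      ≼-respʳ eq (mono _ _ _ _ mid≼top mid≼top))

  centre : Fin n → Fin n → Fin n
  centre w z = proj₁ (centre-mid w z)

  f-mid-mid : ∀ w z → f (mid w) (mid z) ≡ mid (centre w z)
  f-mid-mid w z = proj₂ (centre-mid w z)

  ≼-centre : ∀ {p} w z → p ≼ f (mid w) (mid z) → p ≼ mid (centre w z)
  ≼-centre w z = ≼-respʳ (f-mid-mid w z)

  centre-≼ : ∀ {p} w z → f (mid w) (mid z) ≼ p → mid (centre w z) ≼ p
  centre-≼ w z = ≼-respˡ (f-mid-mid w z)

  -- By minimality of `bot a`, lowering the second argument from `mid w` to any bottom keeps the
  -- value, so row `x` is constant.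
  row-bot : ∀ {x w a} → f (bot x) (mid w) ≡ bot a → ∀ y → f (bot x) (bot y) ≡ bot a
  row-bot eq y = ≼bot⇒≡ (≼-respʳ eq (monoʳ bot≼mid))

  row-top : ∀ {x w c} → f (top x) (mid w) ≡ top c → ∀ y → f (top x) (top y) ≡ top c
  row-top eq y = top≼⇒≡ (≼-respˡ eq (monoʳ mid≼top))

  -- A centre that varies with the first argument

  module VaryingCentre {z w w′ : Fin n} (c≢c′ : centre w z ≢ centre w′ z) where

    bot-mid : ∀ x → ∃ λ a → f (bot x) (mid z) ≡ bot a
    bot-mid x = ≼mid-≢⇒bot c≢c′ (≼-centre w z (monoˡ bot≼mid)) (≼-centre w′ z (monoˡ bot≼mid))

    top-mid : ∀ x → ∃ λ c → f (top x) (mid z) ≡ top c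
    top-mid x = mid-≢≼⇒top c≢c′ (centre-≼ w z (monoˡ mid≼top)) (centre-≼ w′ z (monoˡ mid≼top))

    g : Elt m n k → Elt m n k
    g x = f x (mid z)

    bot-bot≡g : ∀ x y → f (bot x) (bot y) ≡ g (bot x)
    bot-bot≡g x y = let a , eq = bot-mid x in trans (row-bot eq y) (sym eq)

    top-top≡g : ∀ x y → f (top x) (top y) ≡ g (top x)
    top-top≡g x y = let c , eq = top-mid x in trans (row-top eq y) (sym eq)

    -- The value is below `mid (centre u z′)`, so it is that element or a bottom. A bottom is
    -- excluded: rows of bot × bot are constant, so column `y` alone already contains every `bot a`,
    -- and all of these lie below the value.
    mid-bot : ∀ u y z′ → f (mid u) (bot y) ≡ mid (centre u z′)
    mid-bot u y z′ with ≼mid⇒ (≼-centre u z′ (monoʳ bot≼mid))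
    ... | inj₂ eq = eq
    ... | inj₁ (b , eq) = contradiction eq (≽bots⇒≢bot 2≤m (λ a →
      let x , y′ , eq′ = onto-bot a in
      ≼-respˡ (trans (bot-bot≡g x y) (trans (sym (bot-bot≡g x y′)) eq′)) (monoˡ bot≼mid)) b)

    mid-top : ∀ u y z′ → f (mid u) (top y) ≡ mid (centre u z′)
    mid-top u y z′ with mid≼⇒ (centre-≼ u z′ (monoʳ mid≼top))
    ... | inj₂ eq = eq
    ... | inj₁ (b , eq) = contradiction eq (≼tops⇒≢top 2≤k (λ c →
      let x , y′ , eq′ = onto-top c in
      ≼-respʳ (trans (top-top≡g x y) (trans (sym (top-top≡g x y′)) eq′)) (monoˡ mid≼top)) b)

    mid≡ : ∀ u y → f (mid u) y ≡ mid (centre u z)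
    mid≡ u (bot y) = mid-bot u y z
    -- `mid-bot` holds for every `z′`, so `centre u y` and `centre u z` both equal the value at one
    -- and the same bottom.
    mid≡ u (mid y) = trans (f-mid-mid u y) (trans (sym (mid-bot u b y)) (mid-bot u b z))
      where b = fromℕ< 2≤m
    mid≡ u (top y) = mid-top u y z

    -- The value lies below the two different elements `f (mid w) y` and `f (mid w′) y`, so it is a
    -- bottom; by minimality it agrees with the value at any bottom below `y`.
    bot≡ : ∀ x y → f (bot x) y ≡ g (bot x)
    bot≡ x y with ≼mid-≢⇒bot c≢c′ (≼-respʳ (mid≡ w y) (monoˡ bot≼mid))
                                  (≼-respʳ (mid≡ w′ y) (monoˡ bot≼mid))
                | bot-below x y
    ... | a , eq | b , b≼y =
      trans eq (trans (sym (≼bot⇒≡ (≼-respʳ eq (monoʳ b≼y)))) (bot-bot≡g x b))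

    top≡ : ∀ x y → f (top x) y ≡ g (top x)
    top≡ x y with mid-≢≼⇒top c≢c′ (≼-respˡ (mid≡ w y) (monoˡ mid≼top))
                                  (≼-respˡ (mid≡ w′ y) (monoˡ mid≼top))
                | top-above x y
    ... | c , eq | d , y≼d =
      trans eq (trans (sym (top≼⇒≡ (≼-respˡ eq (monoʳ y≼d)))) (top-top≡g x d))

    f≡g : ∀ x y → f x y ≡ g x
    f≡g (bot x) y = bot≡ x y
    f≡g (mid u) y = trans (mid≡ u y) (sym (f-mid-mid u z))
    f≡g (top x) y = top≡ x y

    g-mono : Monotone₁ _≼_ g
    g-mono x y p = monoˡ p

  -- By `row-bot`, a marked row is constant on bot × bot. These are the rows counted by `α`.
  botRow : Fin n → Fin m → Bool
  botRow w x = isBot (f (bot x) (mid w))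

  topCol : Fin n → Fin k → Bool
  topCol w z = isTop (f (mid w) (top z))

  -- `f` may send two bottoms into the middle; the entry is then a fixed default. Surjectivity and
  -- the constancy of marked rows survive this.
  botTable : Fin m → Fin m → Fin m
  botTable x y = fromBot (fromℕ< 2≤m) (f (bot x) (bot y))

  topTable : Fin k → Fin k → Fin k
  topTable x y = fromTop (fromℕ< 2≤k) (f (top x) (top y))

  botTable-onto : ∀ a → ∃ λ x → ∃ λ y → botTable x y ≡ a
  botTable-onto a = let x , y , eq = onto-bot a in x , y , cong (fromBot _) eq

  topTable-onto : ∀ c → ∃ λ x → ∃ λ y → topTable x y ≡ c
  topTable-onto c = let x , y , eq = onto-top c in x , y , cong (fromTop _) eq

  botRow-constant : ∀ w x → botRow w x ≡ true → ∀ y y′ → botTable x y ≡ botTable x y′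
  botRow-constant w x t y y′ with a , eq ← isBot⇒ _ t =
    cong (fromBot _) (trans (row-bot eq y) (sym (row-bot eq y′)))

  topCol-constant : ∀ w z → topCol w z ≡ true → ∀ x x′ → topTable x z ≡ topTable x′ z
  topCol-constant w z t x x′ with c , eq ← isTop⇒ _ t =
    cong (fromTop _) (trans (col x) (sym (col x′)))
    where
    col : ∀ x → f (top x) (top z) ≡ top c
    col x = top≼⇒≡ (≼-respˡ eq (monoˡ mid≼top))

  -- `f (bot x) (mid w)` lies below both `mid v₀` and `mid v`, and `f (mid w) (top z)` above both.
  -- If either equals `mid v₀`, comparing two middle elements gives `v ≡ v₀`; otherwise they are a
  -- bottom and a top.
  bot-top-value : ∀ {w v₀ x z v} → f (mid w) (mid w) ≡ mid v₀ → f (bot x) (top z) ≡ mid v →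
    v ≡ v₀ ⊎ (botRow w x ≡ true × topCol w z ≡ true)
  bot-top-value {w} {v₀} {x} {z} {v} eq₀ eq
    with ≼mid⇒ (≼-respʳ eq₀ (monoˡ {bot x} {mid w} {mid w} bot≼mid))
       | mid≼⇒ (≼-respˡ eq₀ (monoʳ {mid w} {top z} {mid w} mid≼top))
  ... | inj₁ (_ , eqˣ) | inj₁ (_ , eqᶻ) = inj₂ (cong isBot eqˣ , cong isTop eqᶻ)
  ... | inj₂ eqˣ | _ = inj₁ (sym (mid≼mid⇒≡ (≼-respʳ eq (≼-respˡ eqˣ (monoʳ mid≼top)))))
  ... | inj₁ _ | inj₂ eqᶻ = inj₁ (mid≼mid⇒≡ (≼-respʳ eqᶻ (≼-respˡ eq (monoˡ bot≼mid))))

-- A constant centre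

module ConstantCentre {m n k : ℕ} (2≤m : 2 ≤ m) (2≤k : 2 ≤ k) (P : SurjectivePolymorphism m n k)
  (w₀ v₀ : Fin n) (f≡v₀ : ∀ w z → SurjectivePolymorphism.f P (mid w) (mid z) ≡ mid v₀) where
  open SurjectivePolymorphism P
  private
    module A  = Analysis 2≤m 2≤k P
    module A′ = Analysis 2≤m 2≤k (flipₚ P)
    -- The marked sets have sizes `α`, `β`, `γ`, `δ`: rows and columns of bot × bot, then columns
    -- and rows of top × top.
    PA = partition (A.botRow w₀)
    PB = partition (A′.botRow w₀)
    PC = partition (A.topCol w₀)
    PD = partition (A′.topCol w₀)

  below-centre : ∀ {x y v w z} → f x y ≡ mid v → x ≼ mid w → y ≼ mid z → v ≡ v₀
  below-centre eq p q = mid≼mid⇒≡ (≼-respʳ (f≡v₀ _ _) (≼-respˡ eq (mono _ _ _ _ p q)))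

  above-centre : ∀ {x y v w z} → f x y ≡ mid v → mid w ≼ x → mid z ≼ y → v ≡ v₀
  above-centre eq p q = sym (mid≼mid⇒≡ (≼-respʳ eq (≼-respˡ (f≡v₀ _ _) (mono _ _ _ _ p q))))

  F : Fin (#in PA) → Fin (#in PC) → Fin n
  F i j = fromMid v₀ (f (bot (in-elt PA i)) (top (in-elt PC j)))

  G : Fin (#in PB) → Fin (#in PD) → Fin n
  G i j = fromMid v₀ (f (top (in-elt PD j)) (bot (in-elt PB i)))

  cover : ∀ v → v ≡ v₀ ⊎ (∃ λ i → ∃ λ j → F i j ≡ v) ⊎ (∃ λ i → ∃ λ j → G i j ≡ v)
  cover v = let x , y , eq = onto (mid v) in value x y eq
    where
    value : ∀ x y → f x y ≡ mid v →
      v ≡ v₀ ⊎ (∃ λ i → ∃ λ j → F i j ≡ v) ⊎ (∃ λ i → ∃ λ j → G i j ≡ v)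
    -- Outside bot × top and top × bot, each pair is comparable to a pair of middle elements.
    value (bot _) (bot _) eq = inj₁ (below-centre {w = w₀} {z = w₀} eq bot≼mid bot≼mid)
    value (bot _) (mid _) eq = inj₁ (below-centre {w = w₀} eq bot≼mid ≼-refl)
    value (mid _) (bot _) eq = inj₁ (below-centre {z = w₀} eq ≼-refl bot≼mid)
    value (mid _) (mid _) eq = inj₁ (below-centre eq ≼-refl ≼-refl)
    value (mid _) (top _) eq = inj₁ (above-centre {z = w₀} eq ≼-refl mid≼top)
    value (top _) (mid _) eq = inj₁ (above-centre {w = w₀} eq mid≼top ≼-refl)
    value (top _) (top _) eq = inj₁ (above-centre {w = w₀} {z = w₀} eq mid≼top mid≼top)
    value (bot x) (top z) eq with A.bot-top-value (f≡v₀ w₀ w₀) eq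
    ... | inj₁ v≡v₀ = inj₁ v≡v₀
    ... | inj₂ (tˣ , tᶻ) with i , refl ← in-onto PA x tˣ | j , refl ← in-onto PC z tᶻ =
      inj₂ (inj₁ (i , j , cong (fromMid v₀) eq))
    value (top x) (bot y) eq with A′.bot-top-value (f≡v₀ w₀ w₀) eq
    ... | inj₁ v≡v₀ = inj₁ v≡v₀
    ... | inj₂ (tʸ , tˣ) with i , refl ← in-onto PB y tʸ | j , refl ← in-onto PD x tˣ =
      inj₂ (inj₂ (i , j , cong (fromMid v₀) eq))

  n≤1+B : n ≤ suc (B m k)
  n≤1+B = ≤-trans (covered⇒≤ v₀ F G cover) (s≤s
    (αγ+βδ≤B (#in PA) (#in PB) (#in PC) (#in PD) 2≤m 2≤k (#in≤ PA) (#in≤ PB) (#in≤ PC) (#in≤ PD)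
      (constant-lines-Admissible A.botTable A.botTable-onto
        (A.botRow-constant w₀) (A′.botRow-constant w₀) PA PB)
      -- The flipped table is used because `γ` counts columns of top × top, which are the rows of
      -- its flip.
      (constant-lines-Admissible A′.topTable A′.topTable-onto
        (A.topCol-constant w₀) (A′.topCol-constant w₀) PC PD)))

-- Middle antichains above the bound

module LargeMiddle {m n k : ℕ} (2≤m : 2 ≤ m) (2≤n : 2 ≤ n) (2≤k : 2 ≤ k)
  (1+B<n : suc (B m k) < n) (P : SurjectivePolymorphism m n k) where
  open SurjectivePolymorphism P
  private
    module A  = Analysis 2≤m 2≤k P
    module A′ = Analysis 2≤m 2≤k (flipₚ P)
    w₀ v₀ : Fin n
    w₀ = fromℕ< 2≤n
    v₀ = A.centre w₀ w₀

  centre-flip : ∀ w z → A.centre w z ≡ A′.centre z w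
  centre-flip w z =
    mid≼mid⇒≡ {m} {n} {k} (inj₁ (trans (sym (A.f-mid-mid w z)) (A′.f-mid-mid z w)))

  essentiallyUnary : EssentiallyUnary _≼_ f
  essentiallyUnary with any? (λ w → any? λ z → ¬? (A.centre w z ≟ v₀))
  ... | no ¬varying = contradiction n≤1+B (<⇒≱ 1+B<n)
    where
    open ConstantCentre 2≤m 2≤k P w₀ v₀ (λ w z → trans (A.f-mid-mid w z)
      (cong mid (decidable-stable (A.centre w z ≟ v₀) λ c≢ → ¬varying (w , z , c≢))))
  -- Either the centre changes between `(w , z)` and `(w₀ , z)`, or it changes between `(w₀ , z)`
  -- and `(w₀ , w₀)`. This decides which argument matters.
  ... | yes (w , z , c≢v₀) with A.centre w z ≟ A.centre w₀ z
  ...   | no c≢ = g , g-mono , inj₁ f≡g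
    where open A.VaryingCentre c≢
  ...   | yes c≡ = g , g-mono , inj₂ (λ x y → f≡g y x)
    where
    open A′.VaryingCentre {z = w₀} {w = z} {w′ = w₀} (λ c′≡ →
      c≢v₀ (trans c≡ (trans (centre-flip w₀ z) (trans c′≡ (sym (centre-flip w₀ w₀))))))

-- Polymorphisms depending on both arguments

-- row x ≡ just i says that x is the i-th row marked as constant; rowVal x is
-- junk on the unmarked rows, and likewise for columns.
record Table (m α β : ℕ) : Set where
  field
    entry     : Fin m → Fin m → Fin m
    onto      : ∀ a → ∃ λ x → ∃ λ y → entry x y ≡ a
    row       : Fin m → Maybe (Fin α)
    row-onto  : ∀ i → ∃ λ x → row x ≡ just i
    rowVal    : Fin m → Fin m
    row-const : ∀ {x i} → row x ≡ just i → ∀ y → entry x y ≡ rowVal x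
    col       : Fin m → Maybe (Fin β)
    col-onto  : ∀ j → ∃ λ y → col y ≡ just j
    colVal    : Fin m → Fin m
    col-const : ∀ {y j} → col y ≡ just j → ∀ x → entry x y ≡ colVal y

transpose : ∀ {m α β} → Table m α β → Table m β α
transpose t = record
  { entry = flip entry ; onto = λ a → let x , y , eq = onto a in y , x , eq
  ; row = col ; row-onto = col-onto ; rowVal = colVal ; row-const = col-const
  ; col = row ; col-onto = row-onto ; colVal = rowVal ; col-const = row-const }
  where open Table t

-- All rows are constant and no column is marked; two such tables leave `m * k` free entries.
projectionTable : ∀ m → Table m m 0
projectionTable m = record
  { entry = λ x _ → x ; onto = λ a → a , a , refl
  ; row = just ; row-onto = λ i → i , refl ; rowVal = id ; row-const = λ _ _ → refl
  ; col = λ _ → nothing ; col-onto = λ () ; colVal = id ; col-const = λ () }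

-- The first `α` rows and `β` columns are filled with `zero`. The remaining `α′ * β′` entries take
-- all other values through `clamp`, as `enough` permits.
admissibleTable : ∀ {m α β} → Admissible m α β → Table m α β
admissibleTable {zero} {suc _} record { α+α′≡m = () }
admissibleTable {suc m} {α} {β}
  record { 0<α = 0<α ; 0<β = 0<β ; α′ = α′ ; β′ = β′ ; α+α′≡m = eqα ; β+β′≡m = eqβ ; enough = s≤s enough } = record
  { entry = λ x y → entry (split eqα x) (split eqβ y)
  ; onto = onto
  ; row = λ x → left (split eqα x)
  ; row-onto = λ i → unsplit eqα (inj₁ i) , cong left (split-unsplit eqα (inj₁ i))
  ; rowVal = λ _ → zero
  ; row-const = λ {x} t y → entry-left (split eqα x) t (split eqβ y)
  ; col = λ y → left (split eqβ y)
  ; col-onto = λ j → unsplit eqβ (inj₁ j) , cong left (split-unsplit eqβ (inj₁ j))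
  ; colVal = λ _ → zero
  ; col-const = λ {y} t x → entry-right (split eqβ y) t (split eqα x) }
  where
  split : ∀ {a b} → a + b ≡ suc m → Fin (suc m) → Fin a ⊎ Fin b
  split {a} eq x = splitAt a (cast (sym eq) x)
  unsplit : ∀ {a b} → a + b ≡ suc m → Fin a ⊎ Fin b → Fin (suc m)
  unsplit {a} {b} eq s = cast eq (join a b s)
  split-unsplit : ∀ {a b} (eq : a + b ≡ suc m) s → split eq (unsplit eq s) ≡ s
  split-unsplit {a} {b} eq s =
    trans (cong (splitAt a) (cast-involutive (sym eq) eq (join a b s))) (splitAt-join a b s)
  left : ∀ {a b} → Fin a ⊎ Fin b → Maybe (Fin a)
  left (inj₁ i) = just i
  left (inj₂ _) = nothing
  entry : Fin α ⊎ Fin α′ → Fin β ⊎ Fin β′ → Fin (suc m)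
  entry (inj₁ _) _        = zero
  entry (inj₂ _) (inj₁ _) = zero
  entry (inj₂ i) (inj₂ j) = clamp (combine i j)
  entry-left : ∀ s {i} → left s ≡ just i → ∀ t → entry s t ≡ zero
  entry-left (inj₁ _) _ _ = refl
  entry-right : ∀ t {j} → left t ≡ just j → ∀ s → entry s t ≡ zero
  entry-right (inj₁ _) _ (inj₁ _) = refl
  entry-right (inj₁ _) _ (inj₂ _) = refl
  value : ∀ a → ∃ λ s → ∃ λ t → entry s t ≡ a
  value zero = inj₁ (fromℕ< 0<α) , inj₁ (fromℕ< 0<β) , refl
  value (suc a) with i , eq ← clamp-onto enough a =
    inj₂ (proj₁ (remQuot {α′} β′ i)) , inj₂ (proj₂ (remQuot {α′} β′ i)) ,
    trans (cong clamp (combine-remQuot {α′} β′ i)) eq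
  onto : ∀ a → ∃ λ x → ∃ λ y → entry (split eqα x) (split eqβ y) ≡ a
  onto a = let s , t , eq = value a in unsplit eqα s , unsplit eqβ t ,
    trans (cong₂ entry (split-unsplit eqα s) (split-unsplit eqβ t)) eq

-- Gluing two tables

pick : ∀ {n} {I J : Set} → (I → J → Fin (suc n)) → Maybe I → Maybe J → Fin (suc n)
pick h nothing  _        = zero
pick h (just _) nothing  = zero
pick h (just i) (just j) = h i j

pick-nothing : ∀ {n} {I J : Set} (h : I → J → Fin (suc n)) s → pick h s nothing ≡ zero
pick-nothing h nothing  = refl
pick-nothing h (just _) = refl

module _ {m n k : ℕ} where

  botOrMid : {I : Set} → Maybe I → Fin m → Elt m (suc n) k
  botOrMid (just _) a = bot a
  botOrMid nothing  _ = mid zero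

  topOrMid : {I : Set} → Maybe I → Fin k → Elt m (suc n) k
  topOrMid (just _) c = top c
  topOrMid nothing  _ = mid zero

  -- The marked rows of U are indexed by the second argument, so that the free
  -- entries in bot × top are marked row × marked row.
  glue : ∀ {α β γ δ} → Table m α β → Table k γ δ →
    (Fin α → Fin γ → Fin (suc n)) → (Fin β → Fin δ → Fin (suc n)) →
    Elt m (suc n) k → Elt m (suc n) k → Elt m (suc n) k
  glue L U h₁ h₂ = go
    where
    module L = Table L
    module U = Table U
    go : Elt m (suc n) k → Elt m (suc n) k → Elt m (suc n) k
    go (bot x) (bot y) = bot (L.entry x y)
    go (bot x) (mid _) = botOrMid (L.row x) (L.rowVal x)
    go (bot x) (top z) = mid (pick h₁ (L.row x) (U.row z))
    go (mid _) (bot y) = botOrMid (L.col y) (L.colVal y)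
    go (mid _) (mid _) = mid zero
    go (mid _) (top z) = topOrMid (U.row z) (U.rowVal z)
    go (top x) (bot y) = mid (pick h₂ (L.col y) (U.col x))
    go (top x) (mid _) = topOrMid (U.col x) (U.colVal x)
    go (top x) (top z) = top (U.entry z x)

  module _ {α β γ δ} (L : Table m α β) (U : Table k γ δ)
    (h₁ : Fin α → Fin γ → Fin (suc n)) (h₂ : Fin β → Fin δ → Fin (suc n)) where
    private
      module L = Table L
      module U = Table U

    -- Reduces monotonicity in the second argument to `glue-monoˡ`.
    glue-flip : ∀ x y → glue L U h₁ h₂ x y ≡ glue (transpose L) (transpose U) h₂ h₁ y x
    glue-flip (bot _) (bot _) = refl
    glue-flip (bot _) (mid _) = refl
    glue-flip (bot _) (top _) = refl
    glue-flip (mid _) (bot _) = refl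
    glue-flip (mid _) (mid _) = refl
    glue-flip (mid _) (top _) = refl
    glue-flip (top _) (bot _) = refl
    glue-flip (top _) (mid _) = refl
    glue-flip (top _) (top _) = refl

    -- Along a marked line the table is constant, so the values agree. Along an unmarked line the
    -- value against the middle is `mid zero`, which is comparable to all bottoms and tops, and
    -- `pick` makes the bot × top entries there `mid zero` as well.
    glue-monoˡ : ∀ {x x′} y → x ≼ x′ → glue L U h₁ h₂ x y ≼ glue L U h₁ h₂ x′ y
    glue-monoˡ y (inj₁ refl) = ≼-refl
    glue-monoˡ {bot x} {mid _} (bot y) (inj₂ _) with L.col y in eq
    ... | just _  = inj₁ (cong bot (L.col-const eq x))
    ... | nothing = bot≼mid
    glue-monoˡ {bot x} {mid _} (mid _) (inj₂ _) with L.row x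
    ... | just _  = bot≼mid
    ... | nothing = ≼-refl
    glue-monoˡ {bot x} {mid _} (top z) (inj₂ _) with U.row z
    ... | just _  = mid≼top
    ... | nothing = inj₁ (cong mid (pick-nothing h₁ (L.row x)))
    glue-monoˡ {bot _} {top _} (bot _) (inj₂ _) = bot≼mid
    glue-monoˡ {bot x} {top x′} (mid _) (inj₂ _) with L.row x | U.col x′
    ... | just _  | just _  = bot≼top
    ... | just _  | nothing = bot≼mid
    ... | nothing | just _  = mid≼top
    ... | nothing | nothing = ≼-refl
    glue-monoˡ {bot _} {top _} (top _) (inj₂ _) = mid≼top
    glue-monoˡ {mid _} {top x} (bot y) (inj₂ _) with L.col y
    ... | just _  = bot≼mid
    ... | nothing = ≼-refl
    glue-monoˡ {mid _} {top x} (mid _) (inj₂ _) with U.col x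
    ... | just _  = mid≼top
    ... | nothing = ≼-refl
    glue-monoˡ {mid _} {top x} (top z) (inj₂ _) with U.row z in eq
    ... | just _  = inj₁ (cong top (sym (U.row-const eq x)))
    ... | nothing = mid≼top
    glue-monoˡ {mid _} {bot _} _ (inj₂ ())
    glue-monoˡ {mid _} {mid _} _ (inj₂ (s≤s ()))
    glue-monoˡ {top _} {bot _} _ (inj₂ ())
    glue-monoˡ {top _} {mid _} _ (inj₂ (s≤s ()))
    glue-monoˡ {top _} {top _} _ (inj₂ (s≤s (s≤s ())))

    -- From the value `mid zero` at the centre, a marked row of `U` moves the second argument to a
    -- top value, and a marked row of `L` moves the first to a bottom value.
    glue-not-unary : Fin α → Fin γ → ¬ EssentiallyUnary _≼_ (glue L U h₁ h₂)
    glue-not-unary i j (g , _ , inj₁ f≡g) with z , eq ← U.row-onto j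
      with () ← trans (trans (f≡g (mid zero) (mid zero)) (sym (f≡g (mid zero) (top z))))
                      (cong (λ s → topOrMid s (U.rowVal z)) eq)
    glue-not-unary i j (g , _ , inj₂ f≡g) with x , eq ← L.row-onto i
      with () ← trans (trans (f≡g (mid zero) (mid zero)) (sym (f≡g (bot x) (mid zero))))
                      (cong (λ s → botOrMid s (L.rowVal x)) eq)

    glue-onto : (∀ v → (∃ λ i → ∃ λ j → h₁ i j ≡ suc v) ⊎ (∃ λ i → ∃ λ j → h₂ i j ≡ suc v)) →
      Surjective₂ (glue L U h₁ h₂)
    glue-onto cover (bot a) = let x , y , eq = L.onto a in bot x , bot y , cong bot eq
    glue-onto cover (top c) = let x , y , eq = U.onto c in top y , top x , cong top eq
    glue-onto cover (mid zero) = mid zero , mid zero , refl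
    glue-onto cover (mid (suc v)) with cover v
    ... | inj₁ (i , j , eq) with x , eqˣ ← L.row-onto i | z , eqᶻ ← U.row-onto j =
      bot x , top z , cong mid (trans (cong₂ (pick h₁) eqˣ eqᶻ) eq)
    ... | inj₂ (i , j , eq) with y , eqʸ ← L.col-onto i | x , eqˣ ← U.col-onto j =
      top x , bot y , cong mid (trans (cong₂ (pick h₂) eqʸ eqˣ) eq)

  glue-mono : ∀ {α β γ δ} (L : Table m α β) (U : Table k γ δ)
    (h₁ : Fin α → Fin γ → Fin (suc n)) (h₂ : Fin β → Fin δ → Fin (suc n)) →
    Monotone₂ _≼_ (glue L U h₁ h₂)
  glue-mono L U h₁ h₂ x₁ x₂ y₁ y₂ p q = ≼-trans (glue-monoˡ L U h₁ h₂ x₂ p)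
    (≼-respˡ (sym (glue-flip L U h₁ h₂ y₁ x₂)) (≼-respʳ (sym (glue-flip L U h₁ h₂ y₁ y₂))
      (glue-monoˡ (transpose L) (transpose U) h₂ h₁ y₁ q)))

-- The centre takes `zero`. The other `n` middle elements are spread over one list of free entries:
-- the first `α * γ` belong to `h₁`, the last `β * δ` to `h₂`.
tables⇒¬TwoSlupecki : ∀ {m n k α β γ δ} → Table m α β → Table k γ δ → 0 < α → 0 < γ →
  n ≤ α * γ + β * δ → ¬ TwoSlupecki (Elt m (suc n) k) _≼_
tables⇒¬TwoSlupecki {m} {n} {k} {α} {β} {γ} {δ} L U 0<α 0<γ n≤ slupecki =
  glue-not-unary L U h₁ h₂ (fromℕ< 0<α) (fromℕ< 0<γ)
    (slupecki (glue L U h₁ h₂) (glue-mono L U h₁ h₂) (glue-onto L U h₁ h₂ cover))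
  where
  h₁ : Fin α → Fin γ → Fin (suc n)
  h₁ i j = clamp (combine i j ↑ˡ (β * δ))
  h₂ : Fin β → Fin δ → Fin (suc n)
  h₂ i j = clamp ((α * γ) ↑ʳ combine i j)
  cover : ∀ v → (∃ λ i → ∃ λ j → h₁ i j ≡ suc v) ⊎ (∃ λ i → ∃ λ j → h₂ i j ≡ suc v)
  cover v with i , eq ← clamp-onto n≤ v with splitAt (α * γ) i in eqˢ
  ... | inj₁ l = inj₁ (proj₁ (remQuot {α} γ l) , proj₂ (remQuot {α} γ l) ,
    trans (cong clamp (trans (cong (_↑ˡ (β * δ)) (combine-remQuot {α} γ l)) (splitAt⁻¹-↑ˡ eqˢ))) eq)
  ... | inj₂ r = inj₂ (proj₁ (remQuot {β} δ r) , proj₂ (remQuot {β} δ r) ,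
    trans (cong clamp (trans (cong ((α * γ) ↑ʳ_) (combine-remQuot {β} δ r)) (splitAt⁻¹-↑ʳ eqˢ))) eq)

small-middle⇒¬TwoSlupecki : ∀ {m n k} → 2 ≤ m → 2 ≤ k → n ≤ B m k →
  ¬ TwoSlupecki (Elt m (suc n) k) _≼_
small-middle⇒¬TwoSlupecki {m} {n} {k} 2≤m 2≤k n≤B with ≤B⇒≤mk⊎≤μ m k n≤B
... | inj₁ n≤mk = tables⇒¬TwoSlupecki (projectionTable m) (projectionTable k)
  (<⇒≤ 2≤m) (<⇒≤ 2≤k) (≤-trans n≤mk (m≤m+n (m * k) 0))
... | inj₂ (_ , _ , _ , _ , aₘ , aₖ , n≤μ) =
  tables⇒¬TwoSlupecki (admissibleTable aₘ) (admissibleTable aₖ) (0<α aₘ) (0<α aₖ) n≤μ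

theorem5p5 : ∀ (m n k : ℕ) → 2 ≤ m → 2 ≤ n → 2 ≤ k →
    (TwoSlupecki (Elt m n k) _≼_ ⇔ B m k + 1 < n)
theorem5p5 m (suc n) k 2≤m 2≤n 2≤k = mk⇔
  -- Since `<` is decidable, the contrapositive suffices. The middle has `suc n` elements, so the
  -- negated bound reads `n ≤ B m k`.
  (λ slupecki → decidable-stable (_ <? _) λ B+1≮n → small-middle⇒¬TwoSlupecki 2≤m 2≤k
    (≤-pred (subst (suc n ≤_) (+-comm (B m k) 1) (≮⇒≥ B+1≮n))) slupecki)
  (λ B+1<n f mono onto → LargeMiddle.essentiallyUnary 2≤m 2≤n 2≤k
    (subst (_< suc n) (+-comm (B m k) 1) B+1<n)
    (record { f = f ; mono = mono ; onto = onto }))
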